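{- Let $\phi$ be a sentence of Paraconsistent Dependence Logic $\mathbf{PFO}({=}(\cdot,\cdot))$. Then $\phi$ is positively logically equivalent to some first-order sentence, i.e. there is a first-order sentence $\phi'$ such that for all models $M$ over the signature of $\phi$, $M\models_P^+\phi$ if and only if $M\models\phi'$ in the usual Tarskian sense.
   Context: Models have nonempty domain. A team over $M$ with domain $V$ is a set $X$ of assignments $s:V\to\mathrm{Dom}(M)$. For a team $X$ and $F:X\to\mathcal P(\mathrm{Dom}(M))\setminus\{\emptyset\}$ let $X[F/v]=\{s[m/v]: s\in X,\ m\in F(s)\}$, and let $X[M/v]=\{s[m/v]:s\in X,\ m\in\mathrm{Dom}(M)\}$. $\mathbf{PFO}({=}(\cdot,\cdot))$ has formulas $\psi ::= R\vec t\mid t_1=t_2\mid {=}(\vec t_1,\vec t_2)\mid\lnot\psi\mid\psi\vee\psi\mid\exists v\,\psi$ ($\vec t_1,\vec t_2$ possibly empty tuples of terms; all variables of atoms are free; $\wedge,\forall$ are defined from $\lnot,\vee,\exists$ by De Morgan duality). For teams $X$ whose domain contains the free variables, satisfaction is defined by: - for a first-order atom $\alpha$ ($R\vec t$ or $t_1=t_2$): $(M,X)\models_P^+\alpha$ iff some $s\in X$ has $M\models_s\alpha$; $(M,X)\models_P^-\alpha$ iff some $s\in X$ has $M\not\models_s\alpha$; - $(M,X)\models_P^+{=}(\vec t_1,\vec t_2)$ iff any two $s,s'\in X$ which give $\vec t_1$ the same value also give $\vec t_2$ the same value; $(M,X)\models_P^-{=}(\vec t_1,\vec t_2)$ iff $X\neq\emptyset$;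 - $(M,X)\models_P^{\pm}\lnot\psi$ iff $(M,X)\models_P^{\mp}\psi$; - $(M,X)\models_P^+\psi\vee\theta$ iff $(M,X)\models_P^+\psi$ or $(M,X)\models_P^+\theta$; $(M,X)\models_P^-\psi\vee\theta$ iff for all $Y,Z$ with $X=Y\cup Z$, $(M,Y)\models_P^-\psi$ or $(M,Z)\models_P^-\theta$; - $(M,X)\models_P^+\exists v\psi$ iff $(M,X[M/v])\models_P^+\psi$; $(M,X)\models_P^-\exists v\psi$ iff for all $F:X\to\mathcal P(\mathrm{Dom}(M))\setminus\{\emptyset\}$, $(M,X[F/v])\models_P^-\psi$. For a sentence $\phi$, $M\models_P^{\pm}\phi$ means $(M,\{\emptyset\})\models_P^{\pm}\phi$, where $\{\emptyset\}$ is the team containing only the empty assignment. -}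

module Defs where

open import Level using (Level; Lift; _⊔_) renaming (suc to lsuc)
open import Data.Nat using (ℕ; _≟_)
open import Data.Vec using (Vec; []; _∷_)
open import Data.List using (List; []; _∷_)
open import Data.List.Membership.Propositional using () renaming (_∈_ to _∈ˡ_)
open import Data.List.Relation.Unary.All as All using (All; []; _∷_)
open import Data.Product using (∃-syntax; _×_)
open import Data.Sum using (_⊎_)
open import Relation.Binary.PropositionalEquality using (_≡_)
open import Relation.Nullary using (¬_; yes; no)
open import Relation.Unary using (Pred; _∈_; _∪_; _≐_; Satisfiable)

private variable
  a ℓ : Level

record Signature (a : Level) : Set (lsuc a) where
  field
    Fun      : Set a
    funArity : Fun → ℕ
    Rel      : Set a
    relArity : Rel → ℕ

record Model (𝓢 : Signature a) (ℓ : Level) : Set (a ⊔ lsuc ℓ) where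
  open Signature 𝓢
  field
    Dom       : Set ℓ
    inhabited : Dom
    fun       : (f : Fun) → Vec Dom (funArity f) → Dom
    rel       : (R : Rel) → Vec Dom (relArity R) → Set ℓ

Var : Set
Var = ℕ

-- A finite set of variables, listed without repetition.  Every domain reached
-- from the empty one by `_▸_` is repetition-free.
Domain : Set
Domain = List Var

-- V ∪ {v}; it is V itself when v already belongs to V, so that quantifying
-- a variable again overwrites its value instead of shadowing it.
infixl 6 _▸_
_▸_ : Domain → Var → Domain
[]      ▸ v = v ∷ []
(w ∷ V) ▸ v with v ≟ w
... | yes _ = w ∷ V
... | no  _ = w ∷ (V ▸ v)

module Syntax (𝓢 : Signature a) where
  open Signature 𝓢

  -- Terms and formulas are indexed by a domain containing their free variables.
  data Term (V : Domain) : Set a where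
    var : ∀ {x} → x ∈ˡ V → Term V
    app : (f : Fun) → Vec (Term V) (funArity f) → Term V

  data Atom (V : Domain) : Set a where
    rel : (R : Rel) → Vec (Term V) (relArity R) → Atom V
    _≈_ : Term V → Term V → Atom V

  data FO (V : Domain) : Set a where
    atom : Atom V → FO V
    not  : FO V → FO V
    _or_ : FO V → FO V → FO V
    ex   : (v : Var) → FO (V ▸ v) → FO V

  data PFO (V : Domain) : Set a where
    atom : Atom V → PFO V
    dep  : ∀ {m n} → Vec (Term V) m → Vec (Term V) n → PFO V
    not  : PFO V → PFO V
    _or_ : PFO V → PFO V → PFO V
    ex   : (v : Var) → PFO (V ▸ v) → PFO V

  FOSentence PFOSentence : Set a
  FOSentence  = FO []
  PFOSentence = PFO []

open Syntax public using (FOSentence; PFOSentence)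

module Semantics {𝓢 : Signature a} (M : Model 𝓢 ℓ) where
  open Syntax 𝓢
  open Model M renaming (rel to relᴹ; fun to funᴹ)

  private variable
    V : Domain

  Assignment : Domain → Set ℓ
  Assignment V = All (λ _ → Dom) V

  _[_/_] : Assignment V → Dom → (v : Var) → Assignment (V ▸ v)
  [] [ m / v ] = m ∷ []
  _[_/_] {V = w ∷ V} (n ∷ s) m v with v ≟ w
  ... | yes _ = m ∷ s
  ... | no  _ = n ∷ (s [ m / v ])

  mutual
    ⟦_⟧ : Term V → Assignment V → Dom
    ⟦ var x∈V ⟧  s = All.lookup s x∈V
    ⟦ app f ts ⟧ s = funᴹ f (⟦ ts ⟧* s)

    ⟦_⟧* : ∀ {n} → Vec (Term V) n → Assignment V → Vec Dom n
    ⟦ [] ⟧*     s = []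
    ⟦ t ∷ ts ⟧* s = ⟦ t ⟧ s ∷ ⟦ ts ⟧* s

  _⊨ᵃ_ : Assignment V → Atom V → Set ℓ
  s ⊨ᵃ rel R ts = relᴹ R (⟦ ts ⟧* s)
  s ⊨ᵃ (t ≈ u)  = ⟦ t ⟧ s ≡ ⟦ u ⟧ s

  _⊨_ : Assignment V → FO V → Set ℓ
  s ⊨ atom α   = s ⊨ᵃ α
  s ⊨ not φ    = ¬ (s ⊨ φ)
  s ⊨ (φ or ψ) = s ⊨ φ ⊎ s ⊨ ψ
  s ⊨ ex v φ   = ∃[ m ] (s [ m / v ]) ⊨ φ

  Team : Domain → Set (lsuc ℓ)
  Team V = Pred (Assignment V) ℓ

  -- F is given on all assignments, but only its values on X matter.
  Nonempty-on : Team V → (Assignment V → Pred Dom ℓ) → Set ℓ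
  Nonempty-on X F = ∀ s → s ∈ X → Satisfiable (F s)

  _⟨_/_⟩ : Team V → (Assignment V → Pred Dom ℓ) → (v : Var) → Team (V ▸ v)
  (X ⟨ F / v ⟩) s′ = ∃[ s ] ∃[ m ] s ∈ X × m ∈ F s × s′ ≡ s [ m / v ]

  _⟨M/_⟩ : Team V → (v : Var) → Team (V ▸ v)
  (X ⟨M/ v ⟩) s′ = ∃[ s ] ∃[ m ] s ∈ X × s′ ≡ s [ m / v ]

  -- Clauses that quantify over teams live one universe up, hence the lifts.
  mutual
    _⊨⁺_ : Team V → PFO V → Set (lsuc ℓ)
    X ⊨⁺ atom α   = Lift _ (∃[ s ] s ∈ X × s ⊨ᵃ α)
    X ⊨⁺ dep t u  = Lift _ (∀ s s′ → s ∈ X → s′ ∈ X →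
                              ⟦ t ⟧* s ≡ ⟦ t ⟧* s′ → ⟦ u ⟧* s ≡ ⟦ u ⟧* s′)
    X ⊨⁺ not φ    = X ⊨⁻ φ
    X ⊨⁺ (φ or ψ) = X ⊨⁺ φ ⊎ X ⊨⁺ ψ
    X ⊨⁺ ex v φ   = (X ⟨M/ v ⟩) ⊨⁺ φ

    _⊨⁻_ : Team V → PFO V → Set (lsuc ℓ)
    X ⊨⁻ atom α   = Lift _ (∃[ s ] s ∈ X × ¬ (s ⊨ᵃ α))
    X ⊨⁻ dep t u  = Lift _ (Satisfiable X)
    X ⊨⁻ not φ    = X ⊨⁺ φ
    X ⊨⁻ (φ or ψ) = ∀ (Y Z : Team _) → X ≐ Y ∪ Z → Y ⊨⁻ φ ⊎ Z ⊨⁻ ψ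
    X ⊨⁻ ex v φ   = ∀ F → Nonempty-on X F → (X ⟨ F / v ⟩) ⊨⁻ φ

infix 4 _⊨ᵀ_ _⊨ᴾ⁺_

_⊨ᵀ_ : {𝓢 : Signature a} → Model 𝓢 ℓ → FOSentence 𝓢 → Set ℓ
M ⊨ᵀ φ = [] ⊨ φ
  where open Semantics M

-- The team {∅} consists of the empty assignment only.
_⊨ᴾ⁺_ : {𝓢 : Signature a} → Model 𝓢 ℓ → PFOSentence 𝓢 → Set (lsuc ℓ)
M ⊨ᴾ⁺ φ = (_≡ []) ⊨⁺ φ
  where open Semantics M

{-# OPTIONS --safe #-}

-- By induction on φ, both X ⊨⁺ φ and X ⊨⁻ φ are equivalent to a disjunction
--   "some s ∈ X satisfies γ"  or  "for some i, all s, s′ ∈ X satisfy ρᵢ(s, s′)"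
-- where γ is first-order and the ρᵢ are finitely many first-order conditions
-- on pairs of assignments.  In the clauses of ⊨⁻ that quantify over Y, Z or
-- over F, it suffices to take the largest Y, Z or F that avoids the γ's of the
-- subformulas.  If it does not cover X, or is empty somewhere, then some s ∈ X
-- satisfies the conjunction of the γ's, or γ for every value of v; otherwise
-- some ρᵢ holds for all pairs avoiding γ, that is, all pairs satisfy
-- "γ(s) or γ(s′) or ρᵢ(s, s′)".
module Submission where

open import Level using (Level; lift; lower)
open import Axiom.DoubleNegationElimination using (em⇒dne)
open import Axiom.ExcludedMiddle using (ExcludedMiddle)
open import Data.List using (List; []; _∷_; _++_; map)
open import Data.List.Extrema.Nat using (max; xs≤max)
open import Data.List.Membership.Propositional using () renaming (_∈_ to _∈ˡ_)
open import Data.List.Relation.Unary.All as All using (All; []; _∷_)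
open import Data.List.Relation.Unary.All.Properties
  using (map-∘; map-cong; lookup-map)
open import Data.List.Relation.Unary.Any as Any using (Any; here; there)
open import Data.List.Relation.Unary.Any.Properties as Any
  using (++⁺ˡ; ++⁺ʳ; ++⁻)
open import Data.Nat using (suc; _≟_; s≤s)
open import Data.Nat.Properties using (>⇒≢)
open import Data.Product using (Σ-syntax; ∃-syntax; _×_; _,_; proj₁; proj₂)
open import Data.Product.Function.NonDependent.Propositional using (_×-⇔_)
open import Data.Sum using (_⊎_; inj₁; inj₂; [_,_])
open import Data.Sum.Function.Propositional using (_⊎-⇔_)
open import Data.Vec using (Vec; []; _∷_)
open import Data.Vec.Properties using (∷-injective)
open import Function using (_∘_)
open import Function.Bundles using (_⇔_; mk⇔; module Equivalence)
open import Function.Construct.Composition renaming (_⇔-∘_ to infixr 8 _⇔-∘_)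
open import Function.Construct.Identity using (⇔-id)
open import Relation.Binary.PropositionalEquality
  using (_≡_; _≢_; refl; sym; trans; cong; cong₂)
open import Relation.Nullary using (¬_; yes; no; contradiction)
open import Relation.Unary using (Pred; _∈_; _⊆_; _∪_; _≐_)
open import Defs

open Equivalence using (to; from)

private variable
  a b ℓ : Level
  V W : Domain

-- Congruence rules for equivalences.

≡⇒⇔ : {A B : Set ℓ} → A ≡ B → A ⇔ B
≡⇒⇔ refl = ⇔-id _

¬-⇔ : {A : Set a} {B : Set b} → A ⇔ B → (¬ A) ⇔ (¬ B)
¬-⇔ e = mk⇔ (_∘ from e) (_∘ to e)

Π-⇔ : {A : Set ℓ} {P : A → Set a} {Q : A → Set b} →
      (∀ x → P x ⇔ Q x) → (∀ x → P x) ⇔ (∀ x → Q x)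
Π-⇔ e = mk⇔ (λ f x → to (e x) (f x)) (λ f x → from (e x) (f x))

∃-⇔ : {A : Set ℓ} {P : A → Set a} {Q : A → Set b} →
      (∀ x → P x ⇔ Q x) → (∃[ x ] P x) ⇔ (∃[ x ] Q x)
∃-⇔ e = mk⇔ (λ (x , p) → x , to (e x) p) (λ (x , q) → x , from (e x) q)

→-⇔ : {A A′ : Set a} {B B′ : Set b} → A ⇔ A′ → B ⇔ B′ → (A → B) ⇔ (A′ → B′)
→-⇔ e f = mk⇔ (λ g → to f ∘ g ∘ from e) (λ g → from f ∘ g ∘ to e)

-- Fresh variables and renamings.

∈-new : ∀ V v → v ∈ˡ V ▸ v
∈-new []      v = here refl
∈-new (w ∷ V) v with v ≟ w
... | yes v≡w = here v≡w
... | no  _   = there (∈-new V v)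

∈-old : ∀ {x} v → x ∈ˡ V → x ∈ˡ V ▸ v
∈-old {w ∷ V} v x∈V with v ≟ w
∈-old v x∈V         | yes _ = x∈V
∈-old v (here x≡w)  | no  _ = here x≡w
∈-old v (there x∈V) | no  _ = there (∈-old v x∈V)

fresh : Domain → Var
fresh V = suc (max 0 V)

fresh≢ : ∀ {x} → x ∈ˡ V → fresh V ≢ x
fresh≢ {V} x∈V = >⇒≢ (s≤s (All.lookup (xs≤max 0 V) x∈V))

-- Same recursion as `_[_/_]`, with entries of any type, so that a renaming can be overwritten at a
-- bound variable just as an assignment is.
update : {B : Set b} → All (λ _ → B) V → B → ∀ v → All (λ _ → B) (V ▸ v)
update []                    y v = y ∷ []
update {V = w ∷ V} (z ∷ f) y v with v ≟ w
... | yes _ = y ∷ f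
... | no  _ = z ∷ update f y v

VarIn : Domain → Set
VarIn W = ∃[ x ] x ∈ˡ W

-- A finite table instead of a function: equality of renamed assignments then follows from pointwise
-- equality without function extensionality.
Renaming : Domain → Domain → Set
Renaming V W = All (λ _ → VarIn W) V

weaken : Renaming V W → ∀ w → Renaming V (W ▸ w)
weaken η w = All.map (λ (x , x∈W) → x , ∈-old w x∈W) η

under : Renaming V W → ∀ v w → Renaming (V ▸ v) (W ▸ w)
under {W = W} η v w = update (weaken η w) (w , ∈-new W w) v

-- Syntax: renaming, derived connectives, normal forms.

module _ {𝓢 : Signature a} where
  open Syntax 𝓢 hiding (FOSentence; PFOSentence)

  mutual
    renameᵗ : Renaming V W → Term V → Term W
    renameᵗ η (var x∈V)  = var (proj₂ (All.lookup η x∈V))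
    renameᵗ η (app f ts) = app f (rename* η ts)

    rename* : ∀ {n} → Renaming V W → Vec (Term V) n → Vec (Term W) n
    rename* η []       = []
    rename* η (t ∷ ts) = renameᵗ η t ∷ rename* η ts

  renameᵃ : Renaming V W → Atom V → Atom W
  renameᵃ η (rel R ts) = rel R (rename* η ts)
  renameᵃ η (t ≈ u)    = renameᵗ η t ≈ renameᵗ η u

  rename : Renaming V W → FO V → FO W
  rename η (atom α)         = atom (renameᵃ η α)
  rename η (not φ)          = not (rename η φ)
  rename η (φ or ψ)         = rename η φ or rename η ψ
  -- The bound variable becomes one outside `W`, so it captures nothing in the image of `η`.
  rename {W = W} η (ex v φ) = ex (fresh W) (rename (under η v (fresh W)) φ)

  infixr 6 _and_

  _and_ : FO V → FO V → FO V
  φ and ψ = not (not φ or not ψ)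

  all : ∀ v → FO (V ▸ v) → FO V
  all v φ = not (ex v (not φ))

  -- There may be no term over `V`, so a quantifier supplies the variable; the formula is valid
  -- because domains are inhabited.
  true false : FO V
  true {V} = ex 0 (atom (var (∈-new V 0) ≈ var (∈-new V 0)))
  false    = not true

  equal : ∀ {n} → Vec (Term V) n → Vec (Term V) n → FO V
  equal []       []       = true
  equal (t ∷ ts) (u ∷ us) = atom (t ≈ u) and equal ts us

  -- `unless` records the passage to a team avoiding `γ`, and `allPairs` the passage to a team
  -- extended at `v`. Both assignments share the domain `V`; their variables are separated only in
  -- `toFO`.
  data PairCondition (V : Domain) : Set a where
    dep      : ∀ {m n} → Vec (Term V) m → Vec (Term V) n → PairCondition V
    unless   : FO V → PairCondition V → PairCondition V
    allPairs : ∀ v → PairCondition (V ▸ v) → PairCondition V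

  -- The two assignments of a pair are read off one assignment along η and η′.
  toFO : Renaming V W → Renaming V W → PairCondition V → FO W
  toFO η η′ (dep t u) =
    not (equal (rename* η t) (rename* η′ t)) or equal (rename* η u) (rename* η′ u)
  toFO η η′ (unless γ ρ) = (rename η γ or rename η′ γ) or toFO η η′ ρ
  toFO {W = W} η η′ (allPairs v ρ) =
    all w (all w′ (toFO (weaken (under η v w) w′) (under (weaken η′ w) v w′) ρ))
    where w  = fresh W
          w′ = fresh (W ▸ w)

  NormalForm : Domain → Set a
  NormalForm V = FO V × List (PairCondition V)

  mutual
    nf⁺ : PFO V → NormalForm V
    nf⁺ (atom α)  = atom α , []
    nf⁺ (dep t u) = false , dep t u ∷ []
    nf⁺ (not φ)   = nf⁻ φ
    nf⁺ (φ or ψ)  = let γ , ρs = nf⁺ φ ; δ , σs = nf⁺ ψ in γ or δ , ρs ++ σs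
    nf⁺ (ex v φ)  = let γ , ρs = nf⁺ φ in ex v γ , map (allPairs v) ρs

    nf⁻ : PFO V → NormalForm V
    nf⁻ (atom α)  = not (atom α) , []
    nf⁻ (dep t u) = true , []
    nf⁻ (not φ)   = nf⁺ φ
    nf⁻ (φ or ψ)  = let γ , ρs = nf⁻ φ ; δ , σs = nf⁻ ψ in
                    γ and δ , map (unless γ) ρs ++ map (unless δ) σs
    -- `unless γ` stands inside `allPairs v` because `γ` is evaluated at the extended assignments.
    nf⁻ (ex v φ)  = let γ , ρs = nf⁻ φ in all v γ , map (allPairs v ∘ unless γ) ρs

  -- On the team of the empty assignment alone, "some s" and "all s, s′" both speak of that
  -- assignment, so the normal form is itself a first-order disjunction.
  sentence : NormalForm [] → FO []
  sentence (γ , [])     = γ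
  sentence (γ , ρ ∷ ρs) = toFO [] [] ρ or sentence (γ , ρs)

module Correctness (em : ExcludedMiddle ℓ) {𝓢 : Signature a} (M : Model 𝓢 ℓ) where
  open Syntax 𝓢 hiding (FOSentence; PFOSentence)
  open Semantics M
  open Model M using (Dom; inhabited) renaming (fun to funᴹ; rel to relᴹ)

  -- Substitution lemma for renamings.

  _∘ᴿ_ : Assignment W → Renaming V W → Assignment V
  s ∘ᴿ η = All.map (λ (_ , x∈W) → All.lookup s x∈W) η

  lookup-new : ∀ (s : Assignment V) m v → All.lookup (s [ m / v ]) (∈-new V v) ≡ m
  lookup-new []                  m v = refl
  lookup-new {V = w ∷ V} (n ∷ s) m v with v ≟ w
  ... | yes refl = refl
  ... | no  _    = lookup-new s m v

  lookup-old : ∀ (s : Assignment V) m {v x} → v ≢ x → (x∈V : x ∈ˡ V) →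
               All.lookup (s [ m / v ]) (∈-old v x∈V) ≡ All.lookup s x∈V
  lookup-old {V = w ∷ V} (n ∷ s) m {v} v≢x x∈V with v ≟ w
  lookup-old (n ∷ s) m v≢x (here x≡w)  | yes v≡w = contradiction (trans v≡w (sym x≡w)) v≢x
  lookup-old (n ∷ s) m v≢x (there x∈V) | yes _   = refl
  lookup-old (n ∷ s) m v≢x (here refl) | no  _   = refl
  lookup-old (n ∷ s) m v≢x (there x∈V) | no  _   = lookup-old s m v≢x x∈V

  ∘ᴿ-update : ∀ (s : Assignment W) (η : Renaming V W) y v →
              s ∘ᴿ update η y v ≡ (s ∘ᴿ η) [ All.lookup s (proj₂ y) / v ]
  ∘ᴿ-update             s []      y v = refl
  ∘ᴿ-update {V = w ∷ V} s (z ∷ η) y v with v ≟ w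
  ... | yes _ = refl
  ... | no  _ = cong (_ ∷_) (∘ᴿ-update s η y v)

  ∘ᴿ-weaken : ∀ (s : Assignment W) m (η : Renaming V W) →
              (s [ m / fresh W ]) ∘ᴿ weaken η (fresh W) ≡ s ∘ᴿ η
  ∘ᴿ-weaken s m η =
    trans (map-∘ η) (map-cong η λ (_ , x∈W) → lookup-old s m (fresh≢ x∈W) x∈W)

  ∘ᴿ-under : ∀ (s : Assignment W) m (η : Renaming V W) v →
             (s [ m / fresh W ]) ∘ᴿ under η v (fresh W) ≡ (s ∘ᴿ η) [ m / v ]
  ∘ᴿ-under {W} s m η v =
    trans (∘ᴿ-update (s [ m / fresh W ]) (weaken η (fresh W)) _ v)
          (cong₂ (λ s n → s [ n / v ]) (∘ᴿ-weaken s m η) (lookup-new s m (fresh W)))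

  mutual
    ⟦renameᵗ⟧ : ∀ s (η : Renaming V W) t → ⟦ renameᵗ η t ⟧ s ≡ ⟦ t ⟧ (s ∘ᴿ η)
    ⟦renameᵗ⟧ s η (var x∈V)  = sym (lookup-map η x∈V)
    ⟦renameᵗ⟧ s η (app f ts) = cong (funᴹ f) (⟦rename*⟧ s η ts)

    ⟦rename*⟧ : ∀ s (η : Renaming V W) {n} (ts : Vec (Term V) n) →
                ⟦ rename* η ts ⟧* s ≡ ⟦ ts ⟧* (s ∘ᴿ η)
    ⟦rename*⟧ s η []       = refl
    ⟦rename*⟧ s η (t ∷ ts) = cong₂ _∷_ (⟦renameᵗ⟧ s η t) (⟦rename*⟧ s η ts)

  ⊨-rename : ∀ s (η : Renaming V W) φ → s ⊨ rename η φ ⇔ (s ∘ᴿ η) ⊨ φ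
  ⊨-rename s η (atom (rel R ts)) = ≡⇒⇔ (cong (relᴹ R) (⟦rename*⟧ s η ts))
  ⊨-rename s η (atom (t ≈ u))    = ≡⇒⇔ (cong₂ _≡_ (⟦renameᵗ⟧ s η t) (⟦renameᵗ⟧ s η u))
  ⊨-rename s η (not φ)           = ¬-⇔ (⊨-rename s η φ)
  ⊨-rename s η (φ or ψ)          = ⊨-rename s η φ ⊎-⇔ ⊨-rename s η ψ
  ⊨-rename {W = W} s η (ex v φ)  = ∃-⇔ λ m →
    ≡⇒⇔ (cong (_⊨ φ) (∘ᴿ-under s m η v)) ⇔-∘
    ⊨-rename (s [ m / fresh W ]) (under η v (fresh W)) φ

  -- Classical semantics of the derived connectives.

  ⊨-true : (s : Assignment V) → s ⊨ true
  ⊨-true s = inhabited , refl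

  ⊨-and : ∀ (s : Assignment V) φ ψ → s ⊨ (φ and ψ) ⇔ (s ⊨ φ × s ⊨ ψ)
  ⊨-and s φ ψ = mk⇔
    (λ h → em⇒dne em (h ∘ inj₁) , em⇒dne em (h ∘ inj₂))
    (λ (p , q) → [ (λ ¬p → ¬p p) , (λ ¬q → ¬q q) ])

  ⊨-all : ∀ (s : Assignment V) v φ → s ⊨ all v φ ⇔ (∀ m → (s [ m / v ]) ⊨ φ)
  ⊨-all s v φ = mk⇔ (λ h m → em⇒dne em (λ ¬p → h (m , ¬p))) (λ h (m , ¬p) → ¬p (h m))

  ⊨-implies : ∀ (s : Assignment V) φ ψ → s ⊨ (not φ or ψ) ⇔ (s ⊨ φ → s ⊨ ψ)
  ⊨-implies s φ ψ = mk⇔ [ (λ ¬p p → contradiction p ¬p) , (λ q _ → q) ] back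
    where
    back : (s ⊨ φ → s ⊨ ψ) → s ⊨ (not φ or ψ)
    back h with em {P = s ⊨ φ}
    ... | yes p  = inj₂ (h p)
    ... | no  ¬p = inj₁ ¬p

  ⊨-equal : ∀ (s : Assignment V) {n} (ts us : Vec (Term V) n) →
            s ⊨ equal ts us ⇔ (⟦ ts ⟧* s ≡ ⟦ us ⟧* s)
  ⊨-equal s []       []       = mk⇔ (λ _ → refl) (λ _ → ⊨-true s)
  ⊨-equal s (t ∷ ts) (u ∷ us) =
    mk⇔ (λ (p , q) → cong₂ _∷_ p q) ∷-injective ⇔-∘
    (⇔-id _ ×-⇔ ⊨-equal s ts us) ⇔-∘ ⊨-and s (atom (t ≈ u)) (equal ts us)

  -- Pair conditions and their first-order translation.

  Holds : PairCondition V → Assignment V → Assignment V → Set ℓ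
  Holds (dep t u)    s s′ = ⟦ t ⟧* s ≡ ⟦ t ⟧* s′ → ⟦ u ⟧* s ≡ ⟦ u ⟧* s′
  Holds (unless γ ρ) s s′ = (s ⊨ γ ⊎ s′ ⊨ γ) ⊎ Holds ρ s s′
  Holds (allPairs v ρ)    s s′ = ∀ m m′ → Holds ρ (s [ m / v ]) (s′ [ m′ / v ])

  ⊨-equal-rename : ∀ s (η η′ : Renaming V W) {n} (ts : Vec (Term V) n) →
    s ⊨ equal (rename* η ts) (rename* η′ ts) ⇔ (⟦ ts ⟧* (s ∘ᴿ η) ≡ ⟦ ts ⟧* (s ∘ᴿ η′))
  ⊨-equal-rename s η η′ ts =
    ≡⇒⇔ (cong₂ _≡_ (⟦rename*⟧ s η ts) (⟦rename*⟧ s η′ ts)) ⇔-∘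
    ⊨-equal s (rename* η ts) (rename* η′ ts)

  ⊨-toFO : ∀ s (η η′ : Renaming V W) ρ →
           s ⊨ toFO η η′ ρ ⇔ Holds ρ (s ∘ᴿ η) (s ∘ᴿ η′)
  ⊨-toFO s η η′ (dep t u) =
    →-⇔ (⊨-equal-rename s η η′ t) (⊨-equal-rename s η η′ u) ⇔-∘
    ⊨-implies s (equal (rename* η t) (rename* η′ t)) (equal (rename* η u) (rename* η′ u))
  ⊨-toFO s η η′ (unless γ ρ) =
    (⊨-rename s η γ ⊎-⇔ ⊨-rename s η′ γ) ⊎-⇔ ⊨-toFO s η η′ ρ
  ⊨-toFO {V = V} {W = W} s η η′ (allPairs v ρ) =
    Π-⇔ (λ m → Π-⇔ (λ m′ →
      ≡⇒⇔ (cong₂ (Holds ρ) (left m m′) (right m m′)) ⇔-∘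
      ⊨-toFO (extended m m′) ηᵥ ηᵥ′ ρ) ⇔-∘ ⊨-all (s [ m / w ]) w′ (toFO ηᵥ ηᵥ′ ρ)) ⇔-∘
    ⊨-all s w (all w′ (toFO ηᵥ ηᵥ′ ρ))
    where
    w  = fresh W
    w′ = fresh (W ▸ w)
    ηᵥ ηᵥ′ : Renaming (V ▸ v) (W ▸ w ▸ w′)
    ηᵥ  = weaken (under η v w) w′
    ηᵥ′ = under (weaken η′ w) v w′
    extended : Dom → Dom → Assignment (W ▸ w ▸ w′)
    extended m m′ = s [ m / w ] [ m′ / w′ ]
    -- The value of `v` in the first assignment is stored at `w`, that in the second at `w′`; each
    -- copy is weakened past the variable of the other.
    left : ∀ m m′ → extended m m′ ∘ᴿ ηᵥ ≡ (s ∘ᴿ η) [ m / v ]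
    left m m′ = trans (∘ᴿ-weaken (s [ m / w ]) m′ (under η v w)) (∘ᴿ-under s m η v)
    right : ∀ m m′ → extended m m′ ∘ᴿ ηᵥ′ ≡ (s ∘ᴿ η′) [ m′ / v ]
    right m m′ = trans (∘ᴿ-under (s [ m / w ]) m′ (weaken η′ w) v)
                       (cong (_[ m′ / v ]) (∘ᴿ-weaken s m η′))

  -- Normal forms evaluated on teams.

  SomeIn : Team V → FO V → Set ℓ
  SomeIn X γ = ∃[ s ] s ∈ X × s ⊨ γ

  PairsIn : Team V → PairCondition V → Set ℓ
  PairsIn X ρ = ∀ s s′ → s ∈ X → s′ ∈ X → Holds ρ s s′

  _⊩_ : Team V → NormalForm V → Set _
  X ⊩ (γ , ρs) = SomeIn X γ ⊎ Any (PairsIn X) ρs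

  Avoiding : Team V → FO V → Team V
  Avoiding X γ s = s ∈ X × ¬ s ⊨ γ

  PairsIn-⊆ : {X Y : Team V} (ρ : PairCondition V) → Y ⊆ X → PairsIn X ρ → PairsIn Y ρ
  PairsIn-⊆ ρ Y⊆X h s s′ s∈Y s′∈Y = h s s′ (Y⊆X s∈Y) (Y⊆X s′∈Y)

  -- A pair that is not inside `Avoiding X γ` meets the first alternative of `unless`.
  unless⁺ : ∀ {X : Team V} γ {ρ} → PairsIn (Avoiding X γ) ρ → PairsIn X (unless γ ρ)
  unless⁺ γ h s s′ s∈X s′∈X with em {P = s ⊨ γ} | em {P = s′ ⊨ γ}
  ... | yes p | _      = inj₁ (inj₁ p)
  ... | no  _ | yes p′ = inj₁ (inj₂ p′)
  ... | no ¬p | no ¬p′ = inj₂ (h s s′ (s∈X , ¬p) (s′∈X , ¬p′))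

  -- If no member of `X` satisfies `γ`, the exemption in `unless` never applies and `ρ` itself
  -- remains.
  unless⁻ : ∀ {X : Team V} γ {ρs} → Any (λ ρ → PairsIn X (unless γ ρ)) ρs → X ⊩ (γ , ρs)
  unless⁻ {X = X} γ h with em {P = SomeIn X γ}
  ... | yes p = inj₁ p
  ... | no ¬p = inj₂ (Any.map strip h)
    where
    strip : ∀ {ρ} → PairsIn X (unless γ ρ) → PairsIn X ρ
    strip k s s′ s∈X s′∈X with k s s′ s∈X s′∈X
    ... | inj₁ (inj₁ p) = contradiction (s , s∈X , p) ¬p
    ... | inj₁ (inj₂ p) = contradiction (s′ , s′∈X , p) ¬p
    ... | inj₂ r        = r

  PairsIn-allPairs : ∀ {X : Team V} v ρ → PairsIn X (allPairs v ρ) ⇔ PairsIn (X ⟨M/ v ⟩) ρ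
  PairsIn-allPairs v ρ = mk⇔
    (λ { h _ _ (s , m , s∈X , refl) (s′ , m′ , s′∈X , refl) → h s s′ s∈X s′∈X m m′ })
    (λ h s s′ s∈X s′∈X m m′ → h _ _ (s , m , s∈X , refl) (s′ , m′ , s′∈X , refl))

  ⊩-or⁺ : ∀ (X : Team V) γ ρs δ σs →
          (X ⊩ (γ , ρs) ⊎ X ⊩ (δ , σs)) ⇔ X ⊩ (γ or δ , ρs ++ σs)
  ⊩-or⁺ X γ ρs δ σs = mk⇔ forth back
    where
    forth : X ⊩ (γ , ρs) ⊎ X ⊩ (δ , σs) → X ⊩ (γ or δ , ρs ++ σs)
    forth (inj₁ (inj₁ (s , s∈X , p))) = inj₁ (s , s∈X , inj₁ p)
    forth (inj₁ (inj₂ h))             = inj₂ (++⁺ˡ h)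
    forth (inj₂ (inj₁ (s , s∈X , p))) = inj₁ (s , s∈X , inj₂ p)
    forth (inj₂ (inj₂ h))             = inj₂ (++⁺ʳ ρs h)

    back : X ⊩ (γ or δ , ρs ++ σs) → X ⊩ (γ , ρs) ⊎ X ⊩ (δ , σs)
    back (inj₁ (s , s∈X , inj₁ p)) = inj₁ (inj₁ (s , s∈X , p))
    back (inj₁ (s , s∈X , inj₂ p)) = inj₂ (inj₁ (s , s∈X , p))
    back (inj₂ h)                  = [ inj₁ ∘ inj₂ , inj₂ ∘ inj₂ ] (++⁻ ρs h)

  ⊩-or⁻ : ∀ (X : Team V) γ ρs δ σs →
          (∀ Y Z → X ≐ Y ∪ Z → Y ⊩ (γ , ρs) ⊎ Z ⊩ (δ , σs)) ⇔
          X ⊩ (γ and δ , map (unless γ) ρs ++ map (unless δ) σs)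
  ⊩-or⁻ X γ ρs δ σs = mk⇔ forth back
    where
    forth : (∀ Y Z → X ≐ Y ∪ Z → Y ⊩ (γ , ρs) ⊎ Z ⊩ (δ , σs)) →
            X ⊩ (γ and δ , map (unless γ) ρs ++ map (unless δ) σs)
    forth h with em {P = SomeIn X (γ and δ)}
    ... | yes p = inj₁ p
    -- The two teams may overlap; an assignment missing from both would satisfy `γ and δ`.
    ... | no ¬p with h (Avoiding X γ) (Avoiding X δ) (cover , [ proj₁ , proj₁ ])
      where
      cover : X ⊆ Avoiding X γ ∪ Avoiding X δ
      cover {s} s∈X with em {P = s ⊨ γ}
      ... | no ¬q = inj₁ (s∈X , ¬q)
      ... | yes q = inj₂ (s∈X , λ r → ¬p (s , s∈X , from (⊨-and s γ δ) (q , r)))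
    ... | inj₁ (inj₁ (s , (_ , ¬q) , q)) = contradiction q ¬q
    ... | inj₁ (inj₂ k) = inj₂ (++⁺ˡ (Any.gmap (unless⁺ γ) k))
    ... | inj₂ (inj₁ (s , (_ , ¬q) , q)) = contradiction q ¬q
    ... | inj₂ (inj₂ k) = inj₂ (++⁺ʳ (map (unless γ) ρs) (Any.gmap (unless⁺ δ) k))

    back : X ⊩ (γ and δ , map (unless γ) ρs ++ map (unless δ) σs) →
           ∀ Y Z → X ≐ Y ∪ Z → Y ⊩ (γ , ρs) ⊎ Z ⊩ (δ , σs)
    back (inj₁ (s , s∈X , p)) Y Z (X⊆ , _) with to (⊨-and s γ δ) p | X⊆ s∈X
    ... | q , _ | inj₁ s∈Y = inj₁ (inj₁ (s , s∈Y , q))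
    ... | _ , r | inj₂ s∈Z = inj₂ (inj₁ (s , s∈Z , r))
    -- Exempted pair conditions pass from `X` to its subteams, where `unless⁻` either finds a
    -- witness or removes the exemption.
    back (inj₂ h) Y Z (_ , ⊆X) with ++⁻ (map (unless γ) ρs) h
    ... | inj₁ k = inj₁ (unless⁻ γ
          (Any.map (λ {ρ} → PairsIn-⊆ (unless γ ρ) (⊆X ∘ inj₁)) (Any.map⁻ k)))
    ... | inj₂ k = inj₂ (unless⁻ δ
          (Any.map (λ {ρ} → PairsIn-⊆ (unless δ ρ) (⊆X ∘ inj₂)) (Any.map⁻ k)))

  ⊩-ex⁺ : ∀ (X : Team V) v γ ρs →
          (X ⟨M/ v ⟩) ⊩ (γ , ρs) ⇔ X ⊩ (ex v γ , map (allPairs v) ρs)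
  ⊩-ex⁺ X v γ ρs =
    mk⇔ (λ { (_ , (s , m , s∈X , refl) , p) → s , s∈X , m , p })
        (λ { (s , s∈X , m , p) → _ , (s , m , s∈X , refl) , p })
    ⊎-⇔
    mk⇔ (Any.gmap (λ {ρ} → from (PairsIn-allPairs v ρ)))
        (Any.map (λ {ρ} → to (PairsIn-allPairs v ρ)) ∘ Any.map⁻)

  ⊩-ex⁻ : ∀ (X : Team V) v γ ρs →
          (∀ F → Nonempty-on X F → (X ⟨ F / v ⟩) ⊩ (γ , ρs)) ⇔
          X ⊩ (all v γ , map (allPairs v ∘ unless γ) ρs)
  ⊩-ex⁻ {V = V} X v γ ρs = mk⇔ forth back
    where
    F : Assignment V → Pred Dom ℓ
    F s m = ¬ (s [ m / v ]) ⊨ γ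

    avoiding : Avoiding (X ⟨M/ v ⟩) γ ⊆ (X ⟨ F / v ⟩)
    avoiding ((s , m , s∈X , refl) , ¬q) = s , m , s∈X , ¬q , refl

    forth : (∀ F → Nonempty-on X F → (X ⟨ F / v ⟩) ⊩ (γ , ρs)) →
            X ⊩ (all v γ , map (allPairs v ∘ unless γ) ρs)
    forth h with em {P = SomeIn X (all v γ)}
    ... | yes p = inj₁ p
    ... | no ¬p with h F nonempty
      where
      nonempty : Nonempty-on X F
      -- Emptiness of `F s` is by definition `s ⊨ all v γ`.
      nonempty s s∈X = em⇒dne em λ none → ¬p (s , s∈X , none)
    ... | inj₁ (_ , (s , m , _ , ¬q , refl) , q) = contradiction q ¬q
    ... | inj₂ k = inj₂ (Any.gmap
          (λ {ρ} → from (PairsIn-allPairs v (unless γ ρ)) ∘ unless⁺ γ ∘ PairsIn-⊆ ρ avoiding) k)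

    back : X ⊩ (all v γ , map (allPairs v ∘ unless γ) ρs) →
           ∀ F → Nonempty-on X F → (X ⟨ F / v ⟩) ⊩ (γ , ρs)
    back (inj₁ (s , s∈X , p)) F nonempty =
      -- Nonemptiness of `F s` puts some extension of `s` into the team, and every extension
      -- satisfies `γ`.
      let m , m∈F = nonempty s s∈X in
      inj₁ (_ , (s , m , s∈X , m∈F , refl) , to (⊨-all s v γ) p m)
    back (inj₂ h) F _ = unless⁻ γ (Any.map
      (λ {ρ} → PairsIn-⊆ (unless γ ρ) (λ (s , m , s∈X , _ , e) → s , m , s∈X , e)
               ∘ to (PairsIn-allPairs v (unless γ ρ))) (Any.map⁻ h))

  -- Satisfaction coincides with the normal form.

  mutual
    -- The team stays arbitrary in the induction, since the clauses pass to subteams and to extended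
    -- teams. Quantification over teams is gone on the right-hand side.
    ⊨⁺⇔⊩ : ∀ (X : Team V) φ → X ⊨⁺ φ ⇔ X ⊩ nf⁺ φ
    ⊨⁺⇔⊩ X (atom α)  = mk⇔ (inj₁ ∘ lower) λ { (inj₁ p) → lift p ; (inj₂ ()) }
    ⊨⁺⇔⊩ X (dep t u) = mk⇔ (inj₂ ∘ here ∘ lower) λ
      { (inj₁ (s , _ , p)) → contradiction (⊨-true s) p ; (inj₂ (here h)) → lift h }
    ⊨⁺⇔⊩ X (not φ)   = ⊨⁻⇔⊩ X φ
    ⊨⁺⇔⊩ X (φ or ψ)  = let γ , ρs = nf⁺ φ ; δ , σs = nf⁺ ψ in
      ⊩-or⁺ X γ ρs δ σs ⇔-∘ (⊨⁺⇔⊩ X φ ⊎-⇔ ⊨⁺⇔⊩ X ψ)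
    ⊨⁺⇔⊩ X (ex v φ)  = let γ , ρs = nf⁺ φ in
      ⊩-ex⁺ X v γ ρs ⇔-∘ ⊨⁺⇔⊩ (X ⟨M/ v ⟩) φ

    ⊨⁻⇔⊩ : ∀ (X : Team V) φ → X ⊨⁻ φ ⇔ X ⊩ nf⁻ φ
    ⊨⁻⇔⊩ X (atom α)  = mk⇔ (inj₁ ∘ lower) λ { (inj₁ p) → lift p ; (inj₂ ()) }
    ⊨⁻⇔⊩ X (dep t u) = mk⇔ (λ (lift (s , s∈X)) → inj₁ (s , s∈X , ⊨-true s))
                           (λ { (inj₁ (s , s∈X , _)) → lift (s , s∈X) ; (inj₂ ()) })
    ⊨⁻⇔⊩ X (not φ)   = ⊨⁺⇔⊩ X φ
    ⊨⁻⇔⊩ X (φ or ψ)  = let γ , ρs = nf⁻ φ ; δ , σs = nf⁻ ψ in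
      ⊩-or⁻ X γ ρs δ σs ⇔-∘
      Π-⇔ λ Y → Π-⇔ λ Z → Π-⇔ λ _ → ⊨⁻⇔⊩ Y φ ⊎-⇔ ⊨⁻⇔⊩ Z ψ
    ⊨⁻⇔⊩ X (ex v φ)  = let γ , ρs = nf⁻ φ in
      ⊩-ex⁻ X v γ ρs ⇔-∘ Π-⇔ λ F → Π-⇔ λ _ → ⊨⁻⇔⊩ (X ⟨ F / v ⟩) φ

  ⊩⇔sentence : ∀ γ ρs → (_≡ []) ⊩ (γ , ρs) ⇔ [] ⊨ sentence (γ , ρs)
  ⊩⇔sentence γ [] = mk⇔ (λ { (inj₁ (_ , refl , p)) → p ; (inj₂ ()) }) (λ p → inj₁ ([] , refl , p))
  ⊩⇔sentence γ (ρ ∷ ρs) = mk⇔ forth back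
    where
    IH = ⊩⇔sentence γ ρs

    forth : (_≡ []) ⊩ (γ , ρ ∷ ρs) → [] ⊨ sentence (γ , ρ ∷ ρs)
    forth (inj₁ p)         = inj₂ (to IH (inj₁ p))
    forth (inj₂ (here h))  = inj₁ (from (⊨-toFO [] [] [] ρ) (h [] [] refl refl))
    forth (inj₂ (there k)) = inj₂ (to IH (inj₂ k))

    back : [] ⊨ sentence (γ , ρ ∷ ρs) → (_≡ []) ⊩ (γ , ρ ∷ ρs)
    back (inj₁ p) = inj₂ (here λ { _ _ refl refl → to (⊨-toFO [] [] [] ρ) p })
    back (inj₂ q) with from IH q
    ... | inj₁ p = inj₁ p
    ... | inj₂ k = inj₂ (there k)

theorem4p6 : ∀ {a ℓ} → ExcludedMiddle ℓ → (𝓢 : Signature a) (φ : PFOSentence 𝓢) →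
    Σ[ φ′ ∈ FOSentence 𝓢 ] (∀ (M : Model 𝓢 ℓ) → (M ⊨ᴾ⁺ φ) ⇔ (M ⊨ᵀ φ′))
theorem4p6 em 𝓢 φ = sentence (nf⁺ φ) , λ M →
  let open Correctness em M ; γ , ρs = nf⁺ φ in ⊩⇔sentence γ ρs ⇔-∘ ⊨⁺⇔⊩ _ φ
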